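{- Let $k$ be a positive integer and let $G=(V,E)$ be a finite simple graph of order $n$ with chromatic number $h$. If \[ k > \frac{1}{1 - \left( 1 - \frac{1}{h} \right)^{h/n}}, \] then $\mu(G) \leqslant k-1$.
   Context: Let $G$ be a finite simple graph on the vertex set $\{1,\dots,n\}$ and let $\Gamma$ be a finite set of colors. A strategy for vertex $i$ is a function $F_i:\Gamma^n\to\Gamma$ whose value $F_i(x_1,\dots,x_n)$ depends only on those coordinates $x_j$ for which $j$ is adjacent to $i$ in $G$. A system of strategies $(F_1,\dots,F_n)$ is winning if for every $(x_1,\dots,x_n)\in\Gamma^n$ there is at least one $i$ with $F_i(x_1,\dots,x_n)=x_i$. The hat chromatic number $\mu(G)$ is the largest integer $k=|\Gamma|$ for which a winning system of strategies exists on $G$. -}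

module Defs where

open import Data.Fin using (Fin)
open import Data.Integer as ℤ using (+_)
open import Data.Nat as ℕ using (ℕ; zero; suc)
open import Data.Nat.Coprimality using (1-coprimeTo)
open import Data.Product using (Σ; ∃; ∃-syntax; _×_; _,_)
open import Data.Rational
open import Data.Rational.Properties
open import Data.Rational.Solver using (module +-*-Solver)
open import Data.Sum using (_⊎_; inj₁; inj₂; map; swap)
open import Data.Vec using (Vec; lookup)
open import Function using (_⇔_; mk⇔; Equivalence)
open import Relation.Binary.Definitions using (Decidable; tri<; tri≈; tri>)
open import Relation.Binary.PropositionalEquality
open import Relation.Nullary using (¬_; yes; no; contradiction)

open import Algebra.Definitions.RawSemiring +-*-rawSemiring public using (_^_)

record SimpleGraph (n : ℕ) : Set₁ where
  field
    Adj    : Fin n → Fin n → Set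
    adj?   : Decidable Adj
    symm   : ∀ {i j} → Adj i j → Adj j i
    irrefl : ∀ {i} → ¬ Adj i i

Colorable : ∀ {n} → SimpleGraph n → ℕ → Set
Colorable {n} G h = Σ (Fin n → Fin h) λ c → ∀ i j → Adj i j → c i ≢ c j
  where open SimpleGraph G

IsChromaticNumber : ∀ {n} → SimpleGraph n → ℕ → Set
IsChromaticNumber G h = Colorable G h × (∀ h′ → Colorable G h′ → h ℕ.≤ h′)

-- The colour set Γ is Fin k, and Γⁿ is Vec (Fin k) n.
record Strategy {n} (G : SimpleGraph n) (k : ℕ) (i : Fin n) : Set where
  open SimpleGraph G
  field
    guess : Vec (Fin k) n → Fin k
    local : ∀ x y → (∀ j → Adj i j → lookup x j ≡ lookup y j) → guess x ≡ guess y

open Strategy public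

Winning : ∀ {n} {G : SimpleGraph n} {k} → (∀ i → Strategy G k i) → Set
Winning {n} {k = k} F = (x : Vec (Fin k) n) → ∃[ i ] guess (F i) x ≡ lookup x i

HasWinningSystem : ∀ {n} → SimpleGraph n → ℕ → Set
HasWinningSystem G k = Σ (∀ i → Strategy G k i) Winning

IsHatChromaticNumber : ∀ {n} → SimpleGraph n → ℕ → Set
IsHatChromaticNumber G m =
  HasWinningSystem G m × (∀ k → HasWinningSystem G k → k ℕ.≤ m)

record ℝ : Set₁ where
  field
    Lower Upper     : ℚ → Set
    lower-inhabited : ∃ Lower
    upper-inhabited : ∃ Upper
    lower-rounded   : ∀ p → Lower p ⇔ (∃[ q ] p < q × Lower q)
    upper-rounded   : ∀ p → Upper p ⇔ (∃[ q ] q < p × Upper q)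
    disjoint        : ∀ p → ¬ (Lower p × Upper p)
    located         : ∀ p q → p < q → Lower p ⊎ Upper q

open ℝ public

infix 4 _<ℝ_ _>ℝ_

_<ℝ_ : ℝ → ℝ → Set
x <ℝ y = ∃[ q ] Upper x q × Lower y q

_>ℝ_ : ℝ → ℝ → Set
x >ℝ y = y <ℝ x

-- The real determined by a class A of rationals lying below it (possibly equal
-- to it) and a class B of rationals lying above it (possibly equal to it).
cut : (A B : ℚ → Set) → ∃ A → ∃ B →
      (∀ {p q} → A p → B q → p ≤ q) →
      (∀ p q → p < q → A p ⊎ B q) → ℝ
cut A B (a , Aa) (b , Bb) A≤B A⊎B = record
  { Lower           = λ p → ∃[ q ] p < q × A q
  ; Upper           = λ p → ∃[ q ] q < p × B q
  ; lower-inhabited = a - 1ℚ , a , p-1<p a , Aa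
  ; upper-inhabited = b + 1ℚ , b , p<p+1 b , Bb
  ; lower-rounded   = λ p → mk⇔
      (λ (q , p<q , Aq) → let (m , p<m , m<q) = <-dense p<q in m , p<m , q , m<q , Aq)
      (λ (m , p<m , q , m<q , Aq) → q , <-trans p<m m<q , Aq)
  ; upper-rounded   = λ p → mk⇔
      (λ (q , q<p , Bq) → let (m , q<m , m<p) = <-dense q<p in m , m<p , q , q<m , Bq)
      (λ (m , m<p , q , q<m , Bq) → q , <-trans q<m m<p , Bq)
  ; disjoint        = λ p ((q , p<q , Aq) , (r , r<p , Br)) →
      <-irrefl refl (<-≤-trans (<-trans r<p p<q) (A≤B Aq Br))
  ; located         = λ p q p<q →
      let (r , p<r , r<q) = <-dense p<q
          (s , r<s , s<q) = <-dense r<q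
      in map (λ Ar → r , p<r , Ar) (λ Bs → s , s<q , Bs) (A⊎B r s r<s)
  }
  where
  p<p+1 : ∀ p → p < p + 1ℚ
  p<p+1 p = subst (_< p + 1ℚ) (+-identityʳ p) (+-monoʳ-< p (positive⁻¹ 1ℚ))
  p-1<p : ∀ p → p - 1ℚ < p
  p-1<p p = subst (p - 1ℚ <_) (+-identityʳ p) (+-monoʳ-< p (negative⁻¹ (- 1ℚ)))

lower<upper : ∀ x {p q} → Lower x p → Upper x q → p < q
lower<upper x {p} {q} Lp Uq with <-cmp p q
... | tri< p<q _ _ = p<q
... | tri≈ _ refl _ = contradiction (Lp , Uq) (disjoint x p)
... | tri> _ _ q<p =
  contradiction (Lp , Equivalence.from (upper-rounded x p) (q , q<p , Uq)) (disjoint x p)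

fromℚ : ℚ → ℝ
fromℚ r = cut (_≤ r) (r ≤_) (r , ≤-refl) (r , ≤-refl) ≤-trans comp
  where
  comp : ∀ p q → p < q → p ≤ r ⊎ r ≤ q
  comp p q p<q with ≤-total p r
  ... | inj₁ p≤r = inj₁ p≤r
  ... | inj₂ r≤p = inj₂ (≤-trans r≤p (<⇒≤ p<q))

private
  p-[p-q]≡q : ∀ p q → p - (p - q) ≡ q
  p-[p-q]≡q = solve 2 (λ p q → p :- (p :- q) := q) refl
    where open +-*-Solver

infixl 6 _⊖_

_⊖_ : ℚ → ℝ → ℝ
r ⊖ x = cut (λ p → Upper x (r - p)) (λ p → Lower x (r - p))
  (let (u , Uu) = upper-inhabited x in r - u , subst (Upper x) (sym (p-[p-q]≡q r u)) Uu)
  (let (l , Ll) = lower-inhabited x in r - l , subst (Lower x) (sym (p-[p-q]≡q r l)) Ll)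
  (λ {p} {q} U L → <⇒≤ (subst₂ _<_ (p-[p-q]≡q r p) (p-[p-q]≡q r q) (flip-< (lower<upper x L U))))
  (λ p q p<q → swap (located x (r - q) (r - p) (flip-< p<q)))
  where
  flip-< : ∀ {p q} → p < q → r - q < r - p
  flip-< p<q = +-monoʳ-< r (neg-antimono-< p<q)

0<ℝ⇒lower : ∀ x → fromℚ 0ℚ <ℝ x → ∃[ p ] 0ℚ < p × Lower x p
0<ℝ⇒lower x (p , (q , q<p , 0≤q) , Lp) = p , ≤-<-trans 0≤q q<p , Lp

1/ℝ : (x : ℝ) → fromℚ 0ℚ <ℝ x → ℝ
1/ℝ x 0<x = cut A B inhA inhB A≤B comp
  where
  open ≤-Reasoning

  -- A p says p ≤ 1/b for some b > x; B p says 1/b ≤ p for some 0 < b < x.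
  A B : ℚ → Set
  A p = ∃[ b ] Upper x b × p * b ≤ 1ℚ
  B p = ∃[ b ] 0ℚ < b × Lower x b × 1ℚ ≤ p * b

  upper⇒pos : ∀ {b} → Upper x b → 0ℚ < b
  upper⇒pos Ub = let (p , 0<p , Lp) = 0<ℝ⇒lower x 0<x in <-trans 0<p (lower<upper x Lp Ub)

  nonPos⇒A : ∀ {p} → p ≤ 0ℚ → A p
  nonPos⇒A {p} p≤0 = let (b , Ub) = upper-inhabited x in b , Ub , (begin
    p * b   ≤⟨ *-monoʳ-≤-nonNeg b {{nonNegative (<⇒≤ (upper⇒pos Ub))}} p≤0 ⟩
    0ℚ * b  ≡⟨ *-zeroˡ b ⟩
    0ℚ      ≤⟨ nonNegative⁻¹ 1ℚ ⟩
    1ℚ      ∎)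

  inhA : ∃ A
  inhA = 0ℚ , nonPos⇒A ≤-refl

  inhB : ∃ B
  inhB with 0<ℝ⇒lower x 0<x
  ... | b , 0<b , Lb = 1/ b , b , 0<b , Lb , ≤-reflexive (sym (*-inverseˡ b))
    where instance _ = pos⇒nonZero b {{positive 0<b}}

  A≤B : ∀ {p q} → A p → B q → p ≤ q
  A≤B {p} {q} (b , Ub , pb≤1) (c , 0<c , Lc , 1≤qc) = ≮⇒≥ λ q<p →
    let instance
          c>0 = positive 0<c
          c≥0 = pos⇒nonNeg c
        0<p : 0ℚ < p
        0<p = <-trans (*-cancelʳ-<-nonNeg c (begin-strict
                0ℚ * c  ≡⟨ *-zeroˡ c ⟩
                0ℚ      <⟨ positive⁻¹ 1ℚ ⟩
                1ℚ      ≤⟨ 1≤qc ⟩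
                q * c   ∎)) q<p
    in <-irrefl refl (begin-strict
         1ℚ     ≤⟨ 1≤qc ⟩
         q * c  <⟨ *-monoˡ-<-pos c q<p ⟩
         p * c  <⟨ *-monoʳ-<-pos p {{positive 0<p}} (lower<upper x Lc Ub) ⟩
         p * b  ≤⟨ pb≤1 ⟩
         1ℚ     ∎)

  comp : ∀ p q → p < q → A p ⊎ B q
  comp p q p<q with p ≤? 0ℚ
  ... | yes p≤0 = inj₁ (nonPos⇒A p≤0)
  ... | no  p≰0 = go (located x (1/ q) (1/ p) 1/q<1/p)
    where
    instance
      p>0 : Positive p
      p>0 = positive (≰⇒> p≰0)
      p≥0 : NonNegative p
      p≥0 = pos⇒nonNeg p
      q>0 : Positive q
      q>0 = positive (<-trans (≰⇒> p≰0) p<q)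
      p≢0 : NonZero p
      p≢0 = pos⇒nonZero p
      q≢0 : NonZero q
      q≢0 = pos⇒nonZero q
      1/q>0 : Positive (1/ q)
      1/q>0 = 1/pos⇒pos q
    1/q<1/p : 1/ q < 1/ p
    1/q<1/p = *-cancelʳ-<-nonNeg p (begin-strict
      1/ q * p  <⟨ *-monoʳ-<-pos (1/ q) p<q ⟩
      1/ q * q  ≡⟨ *-inverseˡ q ⟩
      1ℚ        ≡⟨ *-inverseˡ p ⟨
      1/ p * p  ∎)
    go : Lower x (1/ q) ⊎ Upper x (1/ p) → A p ⊎ B q
    go (inj₁ L) = inj₂ (1/ q , positive⁻¹ (1/ q) , L , ≤-reflexive (sym (*-inverseʳ q)))
    go (inj₂ U) = inj₁ (1/ p , U , ≤-reflexive (*-inverseʳ p))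

^-nonNeg : ∀ p n → 0ℚ ≤ p → 0ℚ ≤ p ^ n
^-nonNeg p zero    0≤p = nonNegative⁻¹ 1ℚ
^-nonNeg p (suc n) 0≤p = nonNegative⁻¹ (p * p ^ n)
  {{nonNeg*nonNeg⇒nonNeg p {{nonNegative 0≤p}} (p ^ n) {{nonNegative (^-nonNeg p n 0≤p)}}}}

^-monoˡ-≤ : ∀ n {p q} → 0ℚ ≤ p → p ≤ q → p ^ n ≤ q ^ n
^-monoˡ-≤ zero            0≤p p≤q = ≤-refl
^-monoˡ-≤ (suc n) {p} {q} 0≤p p≤q = begin
  p * p ^ n  ≤⟨ *-monoˡ-≤-nonNeg p {{nonNegative 0≤p}} (^-monoˡ-≤ n 0≤p p≤q) ⟩
  p * q ^ n  ≤⟨ *-monoʳ-≤-nonNeg (q ^ n) {{nonNegative (^-nonNeg q n (≤-trans 0≤p p≤q))}} p≤q ⟩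
  q * q ^ n  ∎
  where open ≤-Reasoning

^-monoˡ-< : ∀ n .{{_ : ℕ.NonZero n}} {p q} → 0ℚ ≤ p → p < q → p ^ n < q ^ n
^-monoˡ-< (suc n) {p} {q} 0≤p p<q = begin-strict
  p * p ^ n  ≤⟨ *-monoˡ-≤-nonNeg p {{nonNegative 0≤p}} (^-monoˡ-≤ n 0≤p (<⇒≤ p<q)) ⟩
  p * q ^ n  <⟨ *-monoˡ-<-pos (q ^ n) {{positive (^-pos n)}} p<q ⟩
  q * q ^ n  ∎
  where
  open ≤-Reasoning
  0<q : 0ℚ < q
  0<q = ≤-<-trans 0≤p p<q
  ^-pos : ∀ n → 0ℚ < q ^ n
  ^-pos zero    = positive⁻¹ 1ℚ
  ^-pos (suc n) = positive⁻¹ (q * q ^ n)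
    {{pos*pos⇒pos q {{positive 0<q}} (q ^ n) {{positive (^-pos n)}}}}

1^n≡1 : ∀ n → 1ℚ ^ n ≡ 1ℚ
1^n≡1 zero    = refl
1^n≡1 (suc n) = trans (*-identityˡ (1ℚ ^ n)) (1^n≡1 n)

p≤p^n : ∀ n .{{_ : ℕ.NonZero n}} {p} → 1ℚ ≤ p → p ≤ p ^ n
p≤p^n (suc n) {p} 1≤p = begin
  p           ≡⟨ *-identityʳ p ⟨
  p * 1ℚ      ≡⟨ cong (p *_) (1^n≡1 n) ⟨
  p * 1ℚ ^ n  ≤⟨ *-monoˡ-≤-nonNeg p {{nonNegative (≤-trans (nonNegative⁻¹ 1ℚ) 1≤p)}}
                   (^-monoˡ-≤ n (nonNegative⁻¹ 1ℚ) 1≤p) ⟩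
  p * p ^ n   ∎
  where open ≤-Reasoning

-- The nonnegative n-th root of c ≥ 0 (and 0 for c < 0).
root : (n : ℕ) .{{_ : ℕ.NonZero n}} → ℚ → ℝ
root n c = cut A B (- 1ℚ , inj₁ (negative⁻¹ (- 1ℚ))) inhB A≤B (λ p q p<q → comp p q p<q)
  where
  A B : ℚ → Set
  A p = p < 0ℚ ⊎ p ^ n ≤ c
  B p = 0ℚ ≤ p × c ≤ p ^ n

  inhB : ∃ B
  inhB = 1ℚ ⊔ c , ≤-trans (nonNegative⁻¹ 1ℚ) (p≤p⊔q 1ℚ c)
       , ≤-trans (p≤q⊔p 1ℚ c) (p≤p^n n (p≤p⊔q 1ℚ c))

  A≤B : ∀ {p q} → A p → B q → p ≤ q
  A≤B (inj₁ p<0)  (0≤q , c≤qⁿ) = ≤-trans (<⇒≤ p<0) 0≤q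
  A≤B (inj₂ pⁿ≤c) (0≤q , c≤qⁿ) = ≮⇒≥ λ q<p →
    <-irrefl refl (<-≤-trans (^-monoˡ-< n 0≤q q<p) (≤-trans pⁿ≤c c≤qⁿ))

  comp : ∀ p q → p < q → A p ⊎ B q
  comp p q p<q with p <? 0ℚ
  ... | yes p<0 = inj₁ (inj₁ p<0)
  ... | no  p≮0 with ≤-total (p ^ n) c
  ...   | inj₁ pⁿ≤c = inj₁ (inj₂ pⁿ≤c)
  ...   | inj₂ c≤pⁿ = inj₂ (≤-trans (≮⇒≥ p≮0) (<⇒≤ p<q)
                           , ≤-trans c≤pⁿ (^-monoˡ-≤ n (≮⇒≥ p≮0) (<⇒≤ p<q)))

infixr 8 _^[_/_]

-- The real power c^(p/q), for c ≥ 0.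
_^[_/_] : ℚ → ℕ → (q : ℕ) .{{_ : ℕ.NonZero q}} → ℝ
c ^[ p / q ] = root q (c ^ p)

0≤1-1/n : ∀ n .{{_ : ℕ.NonZero n}} → 0ℚ ≤ 1ℚ - + 1 / n
0≤1-1/n (suc n) = subst (_≤ 1ℚ - + 1 / suc n) (+-inverseʳ (+ 1 / suc n))
  (+-monoˡ-≤ (- (+ 1 / suc n)) 1/n≤1)
  where
  1/n≤1 : + 1 / suc n ≤ 1ℚ
  1/n≤1 = subst (_≤ 1ℚ) (sym (normalize-coprime (1-coprimeTo (suc n))))
    (*≤* (ℤ.+≤+ (ℕ.s≤s ℕ.z≤n)))

1-1/n<1 : ∀ n .{{_ : ℕ.NonZero n}} → 1ℚ - + 1 / n < 1ℚ
1-1/n<1 n = +-monoʳ-< 1ℚ (neg-antimono-< (positive⁻¹ (+ 1 / n) {{normalize-pos 1 n}}))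

<1⇒∃^≥ : ∀ n {c} → 0ℚ ≤ c → c < 1ℚ → ∃[ m ] 0ℚ ≤ m × m < 1ℚ × c ≤ m ^ n
<1⇒∃^≥ zero    0≤c c<1 = 0ℚ , ≤-refl , positive⁻¹ 1ℚ , <⇒≤ c<1
<1⇒∃^≥ (suc n) {c} 0≤c c<1 with <-dense c<1
... | d , c<d , d<1 with <1⇒∃^≥ n (≤-trans 0≤c (<⇒≤ c<d)) d<1
...   | m , 0≤m , m<1 , d≤mⁿ = m ⊔ e , 0≤m⊔e , m⊔e<1 , (begin
  c                        ≡⟨ e*d≡c ⟨
  e * d                    ≤⟨ *-monoʳ-≤-nonNeg d (p≤q⊔p m e) ⟩
  (m ⊔ e) * d              ≤⟨ *-monoˡ-≤-nonNeg (m ⊔ e) {{nonNegative 0≤m⊔e}} d≤mⁿ ⟩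
  (m ⊔ e) * m ^ n          ≤⟨ *-monoˡ-≤-nonNeg (m ⊔ e) {{nonNegative 0≤m⊔e}}
                                (^-monoˡ-≤ n 0≤m (p≤p⊔q m e)) ⟩
  (m ⊔ e) * (m ⊔ e) ^ n    ∎)
  where
  open ≤-Reasoning
  instance
    d>0 : Positive d
    d>0 = positive (≤-<-trans 0≤c c<d)
    d≥0 : NonNegative d
    d≥0 = pos⇒nonNeg d
    d≢0 : NonZero d
    d≢0 = pos⇒nonZero d
  e : ℚ
  e = c * 1/ d
  e*d≡c : e * d ≡ c
  e*d≡c = trans (*-assoc c (1/ d) d) (trans (cong (c *_) (*-inverseˡ d)) (*-identityʳ c))
  e<1 : e < 1ℚ
  e<1 = *-cancelʳ-<-nonNeg d (subst₂ _<_ (sym e*d≡c) (sym (*-identityˡ d)) c<d)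
  0≤m⊔e : 0ℚ ≤ m ⊔ e
  0≤m⊔e = ≤-trans 0≤m (p≤p⊔q m e)
  m⊔e<1 : m ⊔ e < 1ℚ
  m⊔e<1 with ⊔-sel m e
  ... | inj₁ eq = subst (_< 1ℚ) (sym eq) m<1
  ... | inj₂ eq = subst (_< 1ℚ) (sym eq) e<1

0<1-c^[p/q] : ∀ {c} p q .{{_ : ℕ.NonZero p}} .{{_ : ℕ.NonZero q}} →
              0ℚ ≤ c → c < 1ℚ → fromℚ 0ℚ <ℝ 1ℚ ⊖ c ^[ p / q ]
0<1-c^[p/q] {c} p q 0≤c c<1
  with <1⇒∃^≥ q (^-nonNeg c p 0≤c) (subst (c ^ p <_) (1^n≡1 p) (^-monoˡ-< p 0≤c c<1))
... | m , 0≤m , m<1 , cᵖ≤m^q with <-dense m<1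
...   | e , m<e , e<1 with <-dense (subst (_< 1ℚ - e) (+-inverseʳ e) (+-monoˡ-< (- e) e<1))
...     | t , 0<t , t<1-e = t , (0ℚ , 0<t , ≤-refl)
  , (1ℚ - e , t<1-e , m , subst (m <_) (sym (p-[p-q]≡q 1ℚ e)) m<e , 0≤m , cᵖ≤m^q)

0<1-[1-1/h]^[h/n] : ∀ h n .{{_ : ℕ.NonZero h}} .{{_ : ℕ.NonZero n}} →
                    fromℚ 0ℚ <ℝ 1ℚ ⊖ (1ℚ - + 1 / h) ^[ h / n ]
0<1-[1-1/h]^[h/n] h n = 0<1-c^[p/q] h n (0≤1-1/n h) (1-1/n<1 h)

{-# OPTIONS --safe #-}
module Submission where

-- Fix a proper colouring of G with h classes and suppose m hat colours admit a winning system.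
-- A class sees only hats outside it, so the proportion of placements in which all nᵢ vertices
-- of the i-th class guess wrong is exactly (1 - 1/m)^nᵢ. In every placement some class guesses
-- right, so these h proportions add up to at most h - 1, and their product (1 - 1/m)^n is at
-- most (1 - 1/h)^h by AM-GM; the hypothesis says that (1 - 1/k)^n exceeds (1 - 1/h)^h.

open import Defs
open import Algebra.Bundles using (module CommutativeRing)
open import Data.Bool using (Bool; true; false; if_then_else_)
open import Data.Fin using (Fin; zero; suc; _≟_)
import Data.Integer as ℤ
open import Data.Integer using (+_)
import Data.Integer.Properties as ℤ
open import Data.Nat using (ℕ; NonZero; _≤_; _∸_)
open import Data.Nat as ℕ using (zero; suc; _+_; _*_; _<_; z≤n; s≤s; s≤s⁻¹)
open import Data.Nat.Properties as ℕ hiding (_≟_; ^-monoˡ-<)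
open import Data.Nat.Tactic.RingSolver using (solve-∀)
open import Data.Product using (∃-syntax; _×_; _,_)
open import Data.Rational using (1ℚ; _-_; _/_)
open import Data.Rational as ℚ using (ℚ; 0ℚ; toℚᵘ)
import Data.Rational.Properties as ℚ
open import Data.Rational.Solver using (module +-*-Solver)
open import Data.Rational.Unnormalised as ℚᵘ using (mkℚᵘ)
import Data.Rational.Unnormalised.Properties as ℚᵘ
open import Data.Sum using (inj₁; inj₂)
open import Data.Vec using (Vec; []; _∷_; lookup)
open import Function using (_∘_)
open import Relation.Binary.PropositionalEquality
open import Relation.Nullary using (does; yes; contradiction)
open import Relation.Nullary.Decidable using (dec-true; dec-false)

open import Algebra.Properties.Semiring.Sum +-*-semiring
  using (sum; sum-cong-≗; ∑-comm; *-distribˡ-sum)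
open import Algebra.Properties.CommutativeMonoid.Sum *-1-commutativeMonoid
  using () renaming (sum to product; sum-cong-≗ to product-cong; ∑-comm to ∏-comm)
open import Algebra.Properties.CommutativeSemiring.Exp
  (CommutativeRing.commutativeSemiring ℚ.+-*-commutativeRing) using (^-distrib-*)

-- Powers, finite sums and finite products of natural numbers.

^-distribʳ-* : ∀ x y n → (x * y) ℕ.^ n ≡ x ℕ.^ n * y ℕ.^ n
^-distribʳ-* x y zero    = refl
^-distribʳ-* x y (suc n) =
  trans (cong (x * y *_) (^-distribʳ-* x y n)) (interchange x y (x ℕ.^ n) (y ℕ.^ n))
  where
  interchange : ∀ a b c d → a * b * (c * d) ≡ a * c * (b * d)
  interchange = solve-∀

sum-const : ∀ n x → sum {n} (λ _ → x) ≡ n * x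
sum-const zero    x = refl
sum-const (suc n) x = cong (x ℕ.+_) (sum-const n x)

product-const : ∀ n x → product {n} (λ _ → x) ≡ x ℕ.^ n
product-const zero    x = refl
product-const (suc n) x = cong (x *_) (product-const n x)

product≤1 : ∀ {n} (f : Fin n → ℕ) → (∀ i → f i ≤ 1) → product f ≤ 1
product≤1 {zero}  f f≤1 = ≤-refl
product≤1 {suc n} f f≤1 = *-mono-≤ (f≤1 zero) (product≤1 (f ∘ suc) (f≤1 ∘ suc))

product≡0 : ∀ {n} (f : Fin n → ℕ) i → f i ≡ 0 → product f ≡ 0
product≡0 f zero    fi≡0 = cong (_* product (f ∘ suc)) fi≡0
product≡0 f (suc i) fi≡0 =
  trans (cong (f zero *_) (product≡0 (f ∘ suc) i fi≡0)) (*-zeroʳ (f zero))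

sum≤n : ∀ {n} (f : Fin n → ℕ) → (∀ i → f i ≤ 1) → sum f ≤ n
sum≤n {zero}  f f≤1 = ≤-refl
sum≤n {suc n} f f≤1 = +-mono-≤ (f≤1 zero) (sum≤n (f ∘ suc) (f≤1 ∘ suc))

sum<n : ∀ {n} (f : Fin n → ℕ) → (∀ i → f i ≤ 1) → ∀ j → f j ≡ 0 → sum f < n
sum<n f f≤1 zero fj≡0 rewrite fj≡0 = s≤s (sum≤n (f ∘ suc) (f≤1 ∘ suc))
sum<n f f≤1 (suc j) fj≡0 =
  +-mono-≤-< (f≤1 zero) (sum<n (f ∘ suc) (f≤1 ∘ suc) j fj≡0)

sum-mono-≤ : ∀ {n} {f g : Fin n → ℕ} → (∀ i → f i ≤ g i) → sum f ≤ sum g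
sum-mono-≤ {zero}  f≤g = ≤-refl
sum-mono-≤ {suc n} f≤g = +-mono-≤ (f≤g zero) (sum-mono-≤ (f≤g ∘ suc))

-- The inequality of arithmetic and geometric means.

2xy≤x²+y² : ∀ x y → 2 * (x * y) ≤ x * x + y * y
2xy≤x²+y² x y with ≤-total x y
... | inj₁ x≤y with d , refl ← m≤n⇒∃[o]m+o≡n x≤y =
  subst (2 * (x * (x + d)) ≤_) (square x d) (m≤m+n _ (d * d))
  where
  square : ∀ x d → 2 * (x * (x + d)) + d * d ≡ x * x + (x + d) * (x + d)
  square = solve-∀
... | inj₂ y≤x with d , refl ← m≤n⇒∃[o]m+o≡n y≤x =
  subst (2 * ((y + d) * y) ≤_) (square y d) (m≤m+n _ (d * d))
  where
  square : ∀ y d → 2 * ((y + d) * y) + d * d ≡ (y + d) * (y + d) + y * y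
  square = solve-∀

-- With `y / x = 1 + t` this is `(1 + t)^(n + 1) ≥ 1 + (n + 1) t`, made homogeneous so that no
-- division or subtraction occurs. The induction multiplies the previous case by `y` and adds
-- `(n + 1) x^n` times `(x - y)² ≥ 0`.
bernoulli : ∀ n x y → suc n * (y * x ℕ.^ n) ≤ y ℕ.^ suc n + n * x ℕ.^ suc n
bernoulli zero    x y = ≤-reflexive (base y)
  where
  base : ∀ y → 1 * (y * 1) ≡ y * 1 + 0
  base = solve-∀
-- The term added to both sides brings the coefficient of `y * (x * X)` on the left to `2 * suc n`,
-- ready for `2xy≤x²+y²`.
bernoulli (suc n) x y = +-cancelʳ-≤ (n * (y * (x * X))) _ _ (begin
  suc (suc n) * (y * (x * X)) + n * (y * (x * X))              ≡⟨ eq₁ n x y X ⟩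
  suc n * X * (2 * (x * y))                                    ≤⟨ *-monoʳ-≤ (suc n * X) (2xy≤x²+y² x y) ⟩
  suc n * X * (x * x + y * y)                                  ≡⟨ eq₂ n x y X ⟩
  y * (suc n * (y * X)) + suc n * (x * (x * X))                ≤⟨ +-monoˡ-≤ _ (*-monoʳ-≤ y (bernoulli n x y)) ⟩
  y * (Y + n * (x * X)) + suc n * (x * (x * X))                ≡⟨ eq₃ n x y X Y ⟩
  y * Y + suc n * (x * (x * X)) + n * (y * (x * X))            ∎)
  where
  open ≤-Reasoning
  X = x ℕ.^ n
  Y = y ℕ.^ suc n
  eq₁ : ∀ n x y X → suc (suc n) * (y * (x * X)) + n * (y * (x * X)) ≡ suc n * X * (2 * (x * y))
  eq₁ = solve-∀
  eq₂ : ∀ n x y X → suc n * X * (x * x + y * y) ≡ y * (suc n * (y * X)) + suc n * (x * (x * X))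
  eq₂ = solve-∀
  eq₃ : ∀ n x y X Y → y * (Y + n * (x * X)) + suc n * (x * (x * X))
                    ≡ y * Y + suc n * (x * (x * X)) + n * (y * (x * X))
  eq₃ = solve-∀

-- Bernoulli's inequality for the ratio of the two means, y / x with x = (n + 1) s and
-- y = n (a + s).
am-gm-step : ∀ n .{{_ : NonZero n}} a s →
             suc n ℕ.^ suc n * (a * s ℕ.^ n) ≤ n ℕ.^ n * (a + s) ℕ.^ suc n
am-gm-step n a s = *-cancelˡ-≤ n (+-cancelˡ-≤ (n * (suc n * s * X)) _ _ (begin
  n * (suc n * s * X) + n * (suc n * N * (a * S))              ≡⟨ cong (λ z → n * (suc n * s * z) + n * (suc n * N * (a * S))) X≡ ⟩
  n * (suc n * s * (N * S)) + n * (suc n * N * (a * S))        ≡⟨ eq₁ n a s N S ⟩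
  suc n * (y * (N * S))                                        ≡⟨ cong (λ z → suc n * (y * z)) X≡ ⟨
  suc n * (y * X)                                              ≤⟨ bernoulli n x y ⟩
  y ℕ.^ suc n + n * (x * X)                                    ≡⟨ cong (_+ n * (x * X)) (^-distribʳ-* n (a + s) (suc n)) ⟩
  n * n ℕ.^ n * (a + s) ℕ.^ suc n + n * (x * X)                ≡⟨ +-comm _ (n * (x * X)) ⟩
  n * (x * X) + n * n ℕ.^ n * (a + s) ℕ.^ suc n                ≡⟨ cong (n * (x * X) ℕ.+_) (*-assoc n _ _) ⟩
  n * (x * X) + n * (n ℕ.^ n * (a + s) ℕ.^ suc n)              ∎))
  where
  open ≤-Reasoning
  x = suc n * s
  y = n * (a + s)
  X = x ℕ.^ n
  N = suc n ℕ.^ n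
  S = s ℕ.^ n
  X≡ : X ≡ N * S
  X≡ = ^-distribʳ-* (suc n) s n
  eq₁ : ∀ n a s N S → n * (suc n * s * (N * S)) + n * (suc n * N * (a * S))
                    ≡ suc n * (n * (a + s) * (N * S))
  eq₁ = solve-∀

-- Induction on the number of terms: after multiplication by `n ^ n` the hypothesis bounds the
-- product of the tail, and `am-gm-step` merges the first term into the sum. A single term is
-- treated apart because `am-gm-step` cancels a factor `n`.
am-gm : ∀ n (f : Fin n → ℕ) → n ℕ.^ n * product f ≤ sum f ℕ.^ n
am-gm zero          f = ≤-refl
am-gm (suc zero)    f = ≤-reflexive (base (f zero))
  where
  base : ∀ a → 1 * 1 * (a * 1) ≡ (a + 0) * 1
  base = solve-∀
am-gm (suc n@(suc _)) f = *-cancelˡ-≤ (n ℕ.^ n) {{m^n≢0 n n}} (begin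
  n ℕ.^ n * (suc n ℕ.^ suc n * (f zero * product (f ∘ suc)))  ≡⟨ rearrange (n ℕ.^ n) (suc n ℕ.^ suc n) (f zero) _ ⟩
  suc n ℕ.^ suc n * (f zero * (n ℕ.^ n * product (f ∘ suc)))  ≤⟨ *-monoʳ-≤ (suc n ℕ.^ suc n) (*-monoʳ-≤ (f zero) (am-gm n (f ∘ suc))) ⟩
  suc n ℕ.^ suc n * (f zero * sum (f ∘ suc) ℕ.^ n)            ≤⟨ am-gm-step n (f zero) (sum (f ∘ suc)) ⟩
  n ℕ.^ n * sum f ℕ.^ suc n                                   ∎)
  where
  open ≤-Reasoning
  rearrange : ∀ p q r s → p * (q * (r * s)) ≡ q * (r * (p * s))
  rearrange = solve-∀

-- Summation over all hat placements.

∑ᵛ : ∀ {m} n → (Vec (Fin m) n → ℕ) → ℕ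
∑ᵛ zero    f = f []
∑ᵛ (suc n) f = sum λ a → ∑ᵛ n λ x → f (a ∷ x)

module _ {m : ℕ} where

  ∑ᵛ-mono-≤ : ∀ n {f g : Vec (Fin m) n → ℕ} → (∀ x → f x ≤ g x) → ∑ᵛ n f ≤ ∑ᵛ n g
  ∑ᵛ-mono-≤ zero    f≤g = f≤g []
  ∑ᵛ-mono-≤ (suc n) f≤g = sum-mono-≤ λ a → ∑ᵛ-mono-≤ n λ x → f≤g (a ∷ x)

  ∑ᵛ-cong : ∀ n {f g : Vec (Fin m) n → ℕ} → (∀ x → f x ≡ g x) → ∑ᵛ n f ≡ ∑ᵛ n g
  ∑ᵛ-cong zero    f≗g = f≗g []
  ∑ᵛ-cong (suc n) f≗g = sum-cong-≗ λ a → ∑ᵛ-cong n λ x → f≗g (a ∷ x)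

  ∑ᵛ-const : ∀ n c → ∑ᵛ {m} n (λ _ → c) ≡ m ℕ.^ n * c
  ∑ᵛ-const zero    c = sym (*-identityˡ c)
  ∑ᵛ-const (suc n) c =
    trans (sum-const m _) (trans (cong (m *_) (∑ᵛ-const n c)) (sym (*-assoc m _ c)))

  *-distribˡ-∑ᵛ : ∀ n c (f : Vec (Fin m) n → ℕ) → c * ∑ᵛ n f ≡ ∑ᵛ n (λ x → c * f x)
  *-distribˡ-∑ᵛ zero    c f = refl
  *-distribˡ-∑ᵛ (suc n) c f = trans (*-distribˡ-sum {m} c _)
    (sum-cong-≗ λ a → *-distribˡ-∑ᵛ n c λ x → f (a ∷ x))

  sum-∑ᵛ-comm : ∀ n {l} (f : Fin l → Vec (Fin m) n → ℕ) →
                sum (λ i → ∑ᵛ n (f i)) ≡ ∑ᵛ n λ x → sum λ i → f i x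
  sum-∑ᵛ-comm zero    f = refl
  sum-∑ᵛ-comm (suc n) f = trans (∑-comm λ i a → ∑ᵛ n λ x → f i (a ∷ x))
    (sum-cong-≗ λ a → sum-∑ᵛ-comm n λ i x → f i (a ∷ x))

-- Counting the placements in which a whole class guesses wrong.

-- The flag tells whether the vertex lies in the class considered. Other vertices contribute the
-- neutral factor 1, so a product over all vertices is the 0/1 indicator that every class member
-- misses.
miss : ∀ {m} → Bool → Fin m → Fin m → ℕ
miss true  g a = if does (g ≟ a) then 0 else 1
miss false g a = 1

-- The sum of `miss b g a` over all colours `a`, for any guess `g`.
weight : ℕ → Bool → ℕ
weight m true  = m ∸ 1
weight m false = m

miss≤1 : ∀ {m} b (g a : Fin m) → miss b g a ≤ 1
miss≤1 true g a with does (g ≟ a)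
... | true  = z≤n
... | false = ≤-refl
miss≤1 false g a = ≤-refl

miss-hit : ∀ {m} {b} {g a : Fin m} → b ≡ true → g ≡ a → miss b g a ≡ 0
miss-hit {a = a} refl refl rewrite dec-true (a ≟ a) refl = refl

sum-miss : ∀ {m} (g : Fin m) → sum (miss true g) ≡ m ∸ 1
sum-miss {suc m} zero = trans (sum-const m 1) (*-identityʳ m)
sum-miss {suc (suc m)} (suc g) = cong suc (sum-miss g)

-- Vertex by vertex, exactly one class, its own, gives the factor `m ∸ 1`. The value is the same for
-- every `j`, so class sizes disappear once the products over classes and vertices are exchanged.
product-weight : ∀ h m (j : Fin (suc h)) →
                 product (λ i → weight m (does (j ≟ i))) ≡ (m ∸ 1) * m ℕ.^ h
product-weight h       m zero    = cong ((m ∸ 1) *_) (product-const h m)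
product-weight (suc h) m (suc j) =
  trans (cong (m *_) (product-weight h m j)) (swap m (m ∸ 1) (m ℕ.^ h))
  where
  swap : ∀ a b c → a * (b * c) ≡ b * (a * c)
  swap = solve-∀

allMiss : ∀ {m n} → (Fin n → Bool) → (Fin n → Vec (Fin m) n → Fin m) → Vec (Fin m) n → ℕ
allMiss P g x = product λ v → miss (P v) (g v x) (lookup x v)

-- Once the hats outside the class are fixed, the guesses inside it are constants, each missed by
-- `m ∸ 1` colours, so the count factors over the vertices. The induction strips vertex `zero`,
-- whose hat becomes a parameter of the remaining guesses.
∑-allMiss : ∀ {m} n (P : Fin n → Bool) (g : Fin n → Vec (Fin m) n → Fin m) →
            (∀ v → P v ≡ true → ∀ x y → (∀ j → P j ≡ false → lookup x j ≡ lookup y j) → g v x ≡ g v y) →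
            ∑ᵛ n (allMiss P g) ≡ product (λ v → weight m (P v))
∑-allMiss zero    P g loc = refl
-- Without colours the sum is empty, and the first weight is `0 ∸ 1` or `0`, zero either way.
∑-allMiss {zero}  (suc n) P g loc with P zero
... | true  = refl
... | false = refl
∑-allMiss {m@(suc m′)} (suc n) P g loc = go (P zero) refl
  where
  open ≡-Reasoning
  P′ : Fin n → Bool
  P′ = P ∘ suc
  g′ : Fin m → Fin n → Vec (Fin m) n → Fin m
  g′ a v x = g (suc v) (a ∷ x)
  W = product λ v → weight m (P′ v)

  ih : ∀ a → ∑ᵛ n (allMiss P′ (g′ a)) ≡ W
  ih a = ∑-allMiss n P′ (g′ a) λ v Pv x y x~y → loc (suc v) Pv (a ∷ x) (a ∷ y)
    λ { zero _ → refl ; (suc j) Pj → x~y j Pj }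

  go : ∀ b → P zero ≡ b → ∑ᵛ (suc n) (allMiss P g) ≡ weight m (P zero) * W
  go false P0 = begin
    sum (λ a → ∑ᵛ n λ x → miss (P zero) (g zero (a ∷ x)) a * allMiss P′ (g′ a) x)
      ≡⟨ sum-cong-≗ (λ a → trans (∑ᵛ-cong n λ x → trans
           (cong (λ b → miss b (g zero (a ∷ x)) a * allMiss P′ (g′ a) x) P0) (*-identityˡ _)) (ih a)) ⟩
    sum {m} (λ _ → W)      ≡⟨ sum-const m W ⟩
    m * W                  ≡⟨ cong (λ b → weight m b * W) P0 ⟨
    weight m (P zero) * W  ∎
  -- Vertex `zero` is in the class, so no guess that counts depends on its hat `a`. Colour `zero`
  -- stands in for `a` inside those guesses, and the sum over `a` moves inside, where each `x`
  -- leaves `m′` missing colours.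
  go true P0 = begin
    sum (λ a → ∑ᵛ n λ x → miss (P zero) (g zero (a ∷ x)) a * allMiss P′ (g′ a) x)
      ≡⟨ sum-cong-≗ (λ a → ∑ᵛ-cong n (step a)) ⟩
    sum (λ a → ∑ᵛ n λ x → M x * miss true (g₀ x) a)
      ≡⟨ sum-∑ᵛ-comm n (λ a x → M x * miss true (g₀ x) a) ⟩
    ∑ᵛ n (λ x → sum λ a → M x * miss true (g₀ x) a)
      ≡⟨ ∑ᵛ-cong n (λ x → trans (sym (*-distribˡ-sum (M x) (miss true (g₀ x))))
           (trans (cong (M x *_) (sum-miss (g₀ x))) (*-comm (M x) m′))) ⟩
    ∑ᵛ n (λ x → m′ * M x)  ≡⟨ *-distribˡ-∑ᵛ n m′ M ⟨
    m′ * ∑ᵛ n M            ≡⟨ cong (m′ *_) (ih zero) ⟩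
    m′ * W                 ≡⟨ cong (λ b → weight m b * W) P0 ⟨
    weight m (P zero) * W  ∎
    where
    g₀ : Vec (Fin m) n → Fin m
    g₀ x = g zero (zero ∷ x)
    M : Vec (Fin m) n → ℕ
    M = allMiss P′ (g′ zero)
    forget : ∀ a v x → P v ≡ true → g v (a ∷ x) ≡ g v (zero ∷ x)
    forget a v x Pv = loc v Pv (a ∷ x) (zero ∷ x)
      λ { zero P0′ → contradiction (trans (sym P0) P0′) (λ ()) ; (suc j) _ → refl }
    step : ∀ a x → miss (P zero) (g zero (a ∷ x)) a * allMiss P′ (g′ a) x ≡ M x * miss true (g₀ x) a
    step a x = trans
      (cong₂ _*_ (cong₂ (λ b c → miss b c a) P0 (forget a zero x P0)) (product-cong same))
      (*-comm (miss true (g₀ x) a) (M x))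
      where
      same : ∀ v → miss (P′ v) (g′ a v x) (lookup x v) ≡ miss (P′ v) (g′ zero v x) (lookup x v)
      same v with P′ v in Pv
      ... | true  = cong (λ c → miss true c (lookup x v)) (forget a (suc v) x Pv)
      -- A vertex outside the class may see the hat `a`, but its factor is 1 whatever it guesses.
      ... | false = refl

-- The inequality forced by a winning system.

-- There are `suc h` classes, so divided by `suc h ^ suc h * m ^ n` this is
-- `(1 - 1/m)^n ≤ (1 - 1/(h + 1))^(h + 1)`.
winning⇒≤ : ∀ {n h m} (G : SimpleGraph n) → Colorable G (suc h) → .{{_ : NonZero m}} →
            HasWinningSystem G m →
            suc h ℕ.^ suc h * (m ∸ 1) ℕ.^ n ≤ h ℕ.^ suc h * m ℕ.^ n
winning⇒≤ {n} {h} {m} G (c , proper) (F , wins) =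
  -- Counts replace proportions, so AM-GM produces the total `m ^ n` to the power `suc h`. One copy
  -- stays in the statement and the other `h` cancel.
  *-cancelʳ-≤ _ _ ((m ℕ.^ h) ℕ.^ n) {{m^n≢0 (m ℕ.^ h) n {{m^n≢0 m h}}}} (begin
  H * (m ∸ 1) ℕ.^ n * (m ℕ.^ h) ℕ.^ n         ≡⟨ *-assoc H _ _ ⟩
  H * ((m ∸ 1) ℕ.^ n * (m ℕ.^ h) ℕ.^ n)       ≡⟨ cong (H *_) (^-distribʳ-* (m ∸ 1) (m ℕ.^ h) n) ⟨
  H * ((m ∸ 1) * m ℕ.^ h) ℕ.^ n               ≡⟨ cong (H *_) counts ⟨
  H * product (λ i → ∑ᵛ n (wrong i))          ≤⟨ am-gm (suc h) (λ i → ∑ᵛ n (wrong i)) ⟩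
  sum (λ i → ∑ᵛ n (wrong i)) ℕ.^ suc h        ≤⟨ ℕ.^-monoˡ-≤ (suc h) total ⟩
  (h * m ℕ.^ n) ℕ.^ suc h                     ≡⟨ ^-distribʳ-* h (m ℕ.^ n) (suc h) ⟩
  h ℕ.^ suc h * (m ℕ.^ n * (m ℕ.^ n) ℕ.^ h)   ≡⟨ *-assoc (h ℕ.^ suc h) _ _ ⟨
  h ℕ.^ suc h * m ℕ.^ n * (m ℕ.^ n) ℕ.^ h     ≡⟨ cong (h ℕ.^ suc h * m ℕ.^ n *_) [mⁿ]ʰ≡[mʰ]ⁿ ⟩
  h ℕ.^ suc h * m ℕ.^ n * (m ℕ.^ h) ℕ.^ n     ∎)
  where
  open SimpleGraph G
  open ≤-Reasoning
  H = suc h ℕ.^ suc h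

  [mⁿ]ʰ≡[mʰ]ⁿ : (m ℕ.^ n) ℕ.^ h ≡ (m ℕ.^ h) ℕ.^ n
  [mⁿ]ʰ≡[mʰ]ⁿ =
    trans (^-*-assoc m n h) (trans (cong (m ℕ.^_) (*-comm n h)) (sym (^-*-assoc m h n)))

  inClass : Fin (suc h) → Fin n → Bool
  inClass i v = does (c v ≟ i)

  wrong : Fin (suc h) → Vec (Fin m) n → ℕ
  wrong i = allMiss (inClass i) λ v → guess (F v)

  inClass-local : ∀ i v → inClass i v ≡ true → ∀ x y →
                  (∀ j → inClass i j ≡ false → lookup x j ≡ lookup y j) → guess (F v) x ≡ guess (F v) y
  -- Properness puts every neighbour of `v` outside its class, so agreement off the class covers all
  -- that `v` sees.
  inClass-local i v v∈i x y x~y with yes refl ← c v ≟ i = local (F v) x y λ j v~j →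
    x~y j (dec-false (c j ≟ c v) (proper v j v~j ∘ sym))

  counts : product (λ i → ∑ᵛ n (wrong i)) ≡ ((m ∸ 1) * m ℕ.^ h) ℕ.^ n
  counts = begin-equality
    product (λ i → ∑ᵛ n (wrong i))
      ≡⟨ product-cong (λ i → ∑-allMiss n (inClass i) (λ v → guess (F v)) (inClass-local i)) ⟩
    product (λ i → product λ v → weight m (inClass i v))
      ≡⟨ ∏-comm (λ i v → weight m (inClass i v)) ⟩
    product (λ v → product λ i → weight m (inClass i v))
      ≡⟨ product-cong (λ v → product-weight h m (c v)) ⟩
    product {n} (λ _ → (m ∸ 1) * m ℕ.^ h)
      ≡⟨ product-const n _ ⟩
    ((m ∸ 1) * m ℕ.^ h) ℕ.^ n ∎

  union : ∀ x → sum (λ i → wrong i x) ≤ h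
  -- The vertex `v` that guesses right annihilates the term of its class `c v`, and each of the
  -- `suc h` terms is at most 1.
  union x with v , hit ← wins x = s≤s⁻¹ (sum<n (λ i → wrong i x)
    (λ i → product≤1 {n} _ λ u → miss≤1 (inClass i u) (guess (F u) x) (lookup x u))
    (c v) (product≡0 {n} _ v (miss-hit (dec-true (c v ≟ c v) refl) hit)))

  total : sum (λ i → ∑ᵛ n (wrong i)) ≤ h * m ℕ.^ n
  total = begin
    sum (λ i → ∑ᵛ n (wrong i))            ≡⟨ sum-∑ᵛ-comm n wrong ⟩
    ∑ᵛ n (λ x → sum λ i → wrong i x)      ≤⟨ ∑ᵛ-mono-≤ n union ⟩
    ∑ᵛ {m} n (λ _ → h)                    ≡⟨ ∑ᵛ-const n h ⟩
    m ℕ.^ n * h                           ≡⟨ *-comm (m ℕ.^ n) h ⟩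
    h * m ℕ.^ n                           ∎

-- Natural numbers inside the rationals.

ι : ℕ → ℚ
ι n = + n / 1

-- The basic laws of `ι` are verified through this on unnormalised fractions, where no gcd
-- intervenes.
toℚᵘ-ι : ∀ n → toℚᵘ (ι n) ℚᵘ.≃ mkℚᵘ (+ n) 0
toℚᵘ-ι n = ℚ.toℚᵘ-fromℚᵘ (mkℚᵘ (+ n) 0)

ι-* : ∀ a b → ι (a * b) ≡ ι a ℚ.* ι b
ι-* a b = ℚ.toℚᵘ-injective (begin-equality
  toℚᵘ (ι (a * b))                ≃⟨ toℚᵘ-ι (a * b) ⟩
  mkℚᵘ (+ (a * b)) 0              ≡⟨ cong (λ z → mkℚᵘ z 0) (ℤ.pos-* a b) ⟩
  mkℚᵘ (+ a) 0 ℚᵘ.* mkℚᵘ (+ b) 0  ≃⟨ ℚᵘ.*-cong (toℚᵘ-ι a) (toℚᵘ-ι b) ⟨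
  toℚᵘ (ι a) ℚᵘ.* toℚᵘ (ι b)      ≃⟨ ℚ.toℚᵘ-homo-* (ι a) (ι b) ⟨
  toℚᵘ (ι a ℚ.* ι b)              ∎)
  where open ℚᵘ.≤-Reasoning

ι-suc : ∀ a → ι (suc a) ≡ 1ℚ ℚ.+ ι a
ι-suc a = ℚ.toℚᵘ-injective (begin-equality
  toℚᵘ (ι (suc a))                ≃⟨ toℚᵘ-ι (suc a) ⟩
  mkℚᵘ (+ suc a) 0                ≡⟨ cong (λ z → mkℚᵘ (+ 1 ℤ.+ z) 0) (ℤ.*-identityʳ (+ a)) ⟨
  toℚᵘ 1ℚ ℚᵘ.+ mkℚᵘ (+ a) 0       ≃⟨ ℚᵘ.+-congʳ (toℚᵘ 1ℚ) (toℚᵘ-ι a) ⟨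
  toℚᵘ 1ℚ ℚᵘ.+ toℚᵘ (ι a)         ≃⟨ ℚ.toℚᵘ-homo-+ 1ℚ (ι a) ⟨
  toℚᵘ (1ℚ ℚ.+ ι a)               ∎)
  where open ℚᵘ.≤-Reasoning

ι-suc-1 : ∀ a → ι (suc a) - 1ℚ ≡ ι a
ι-suc-1 a = trans (cong (_- 1ℚ) (ι-suc a)) (cancel (ι a))
  where
  open +-*-Solver
  cancel : ∀ x → 1ℚ ℚ.+ x - 1ℚ ≡ x
  cancel = solve 1 (λ x → con 1ℚ :+ x :- con 1ℚ := x) refl

ι-^ : ∀ a n → ι (a ℕ.^ n) ≡ ι a ^ n
ι-^ a zero    = refl
ι-^ a (suc n) = trans (ι-* a (a ℕ.^ n)) (cong (ι a ℚ.*_) (ι-^ a n))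

ι-cancel-< : ∀ {a b} → ι a ℚ.< ι b → a < b
ι-cancel-< {a} {b} ιa<ιb = ℤ.drop‿+<+ (subst₂ ℤ._<_ (ℤ.*-identityʳ (+ a)) (ℤ.*-identityʳ (+ b))
  (ℚᵘ.drop-*<* (ℚᵘ.<-respˡ-≃ (toℚᵘ-ι a) (ℚᵘ.<-respʳ-≃ (toℚᵘ-ι b) (ℚ.toℚᵘ-mono-< ιa<ιb)))))

ι-nonNeg : ∀ n → ℚ.NonNegative (ι n)
ι-nonNeg n = ℚ.normalize-nonNeg n 1

ι-pos : ∀ n .{{_ : NonZero n}} → ℚ.Positive (ι n)
ι-pos n = ℚ.normalize-pos n 1

ι*1/ : ∀ n → ι (suc n) ℚ.* (+ 1 / suc n) ≡ 1ℚ
ι*1/ n = ℚ.toℚᵘ-injective (begin-equality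
  toℚᵘ (ι (suc n) ℚ.* (+ 1 / suc n))        ≃⟨ ℚ.toℚᵘ-homo-* (ι (suc n)) (+ 1 / suc n) ⟩
  toℚᵘ (ι (suc n)) ℚᵘ.* toℚᵘ (+ 1 / suc n)  ≃⟨ ℚᵘ.*-cong (toℚᵘ-ι (suc n)) (ℚ.toℚᵘ-fromℚᵘ (mkℚᵘ (+ 1) n)) ⟩
  mkℚᵘ (+ suc n) 0 ℚᵘ.* mkℚᵘ (+ 1) n        ≃⟨ ℚᵘ.*≡* (cong +_ (cross n)) ⟩
  toℚᵘ 1ℚ                                   ∎)
  where
  open ℚᵘ.≤-Reasoning
  cross : ∀ n → suc n * 1 * 1 ≡ 1 * (1 * suc n)
  cross = solve-∀

-- From the hypothesis on reals to an inequality between naturals.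

x*[1-y]≡x-x*y : ∀ x y → x ℚ.* (1ℚ - y) ≡ x - x ℚ.* y
x*[1-y]≡x-x*y = solve 2 (λ x y → x :* (con 1ℚ :- y) := x :- x :* y) refl
  where open +-*-Solver

ι*[1-1/n] : ∀ n → ι (suc n) ℚ.* (1ℚ - + 1 / suc n) ≡ ι n
ι*[1-1/n] n = begin
  ι (suc n) ℚ.* (1ℚ - + 1 / suc n)            ≡⟨ x*[1-y]≡x-x*y (ι (suc n)) (+ 1 / suc n) ⟩
  ι (suc n) - ι (suc n) ℚ.* (+ 1 / suc n)     ≡⟨ cong (λ z → ι (suc n) - z) (ι*1/ n) ⟩
  ι (suc n) - 1ℚ                              ≡⟨ ι-suc-1 n ⟩
  ι n                                         ∎
  where
  open ≡-Reasoning

-- The last bound is t < 1 - 1/(k + 1), cleared of division.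
>1/[1-root]⇒∃ : ∀ n .{{_ : NonZero n}} c k (0<1-c : fromℚ 0ℚ <ℝ 1ℚ ⊖ root n c) →
                fromℚ (ι (suc k)) >ℝ 1/ℝ (1ℚ ⊖ root n c) 0<1-c →
                ∃[ t ] 0ℚ ℚ.≤ t × c ℚ.≤ t ^ n × ι (suc k) ℚ.* t ℚ.< ι k
-- Unfolded, the cuts give `1 ≤ p * b` with `p < q < r ≤ K`, hence `1 < K * b`, and a rational `t`
-- at or above the root with `t < 1 - s < 1 - b`.
>1/[1-root]⇒∃ n c k _
  (q , (p , p<q , b , 0<b , (s , b<s , t , t<1-s , 0≤t , c≤tⁿ) , 1≤pb) , r , q<r , r≤k) =
  t , 0≤t , c≤tⁿ , (begin-strict
    K ℚ.* t           <⟨ ℚ.*-monoʳ-<-pos K t<1-b ⟩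
    K ℚ.* (1ℚ - b)    ≡⟨ x*[1-y]≡x-x*y K b ⟩
    K - K ℚ.* b       <⟨ ℚ.+-monoʳ-< K (ℚ.neg-antimono-< 1<Kb) ⟩
    K - 1ℚ            ≡⟨ ι-suc-1 k ⟩
    ι k               ∎)
  where
  open ℚ.≤-Reasoning
  K = ι (suc k)
  instance
    K>0 = ι-pos (suc k)
    b>0 = ℚ.positive 0<b
  t<1-b : t ℚ.< 1ℚ - b
  t<1-b = ℚ.<-trans t<1-s (ℚ.+-monoʳ-< 1ℚ (ℚ.neg-antimono-< b<s))
  1<Kb : 1ℚ ℚ.< K ℚ.* b
  1<Kb = ℚ.≤-<-trans 1≤pb (ℚ.*-monoˡ-<-pos b (ℚ.<-≤-trans (ℚ.<-trans p<q q<r) r≤k))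

-- The rational `t` separates the two sides: `c ^ suc h ≤ t ^ n` on one, and `K * t < k` raised to
-- the power `n` on the other, strict because `n` is nonzero. Multiplying by `H ^ suc h * K ^ n`
-- clears the fractions.
>1/[1-[1-1/h]^[h/n]]⇒< : ∀ n h k .{{_ : NonZero n}} →
  fromℚ (ι (suc k)) >ℝ 1/ℝ (1ℚ ⊖ (1ℚ - + 1 / suc h) ^[ suc h / n ]) (0<1-[1-1/h]^[h/n] (suc h) n) →
  h ℕ.^ suc h * suc k ℕ.^ n < suc h ℕ.^ suc h * k ℕ.^ n
>1/[1-[1-1/h]^[h/n]]⇒< n h k k> =
  let (t , 0≤t , cʰ≤tⁿ , Kt<k) =
        >1/[1-root]⇒∃ n (c ^ suc h) k (0<1-[1-1/h]^[h/n] (suc h) n) k>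
  in ι-cancel-< (begin-strict
    ι (h ℕ.^ suc h * suc k ℕ.^ n)               ≡⟨ ι-*-^ h (suc h) (suc k) n ⟩
    ι h ^ suc h ℚ.* K ^ n                       ≡⟨ cong (λ z → z ^ suc h ℚ.* K ^ n) (ι*[1-1/n] h) ⟨
    (H ℚ.* c) ^ suc h ℚ.* K ^ n                 ≡⟨ cong (ℚ._* K ^ n) (^-distrib-* H c (suc h)) ⟩
    H ^ suc h ℚ.* c ^ suc h ℚ.* K ^ n           ≤⟨ ℚ.*-monoʳ-≤-nonNeg (K ^ n) (ℚ.*-monoˡ-≤-nonNeg (H ^ suc h) cʰ≤tⁿ) ⟩
    H ^ suc h ℚ.* t ^ n ℚ.* K ^ n               ≡⟨ reorder (H ^ suc h) (t ^ n) (K ^ n) ⟩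
    H ^ suc h ℚ.* (K ^ n ℚ.* t ^ n)             ≡⟨ cong (H ^ suc h ℚ.*_) (^-distrib-* K t n) ⟨
    H ^ suc h ℚ.* (K ℚ.* t) ^ n                 <⟨ ℚ.*-monoʳ-<-pos (H ^ suc h) (^-monoˡ-< n (0≤Kt 0≤t) Kt<k) ⟩
    H ^ suc h ℚ.* ι k ^ n                       ≡⟨ ι-*-^ (suc h) (suc h) k n ⟨
    ι (suc h ℕ.^ suc h * k ℕ.^ n)               ∎)
  where
  open ℚ.≤-Reasoning
  open +-*-Solver using (solve; _:*_; _:=_)
  H = ι (suc h)
  K = ι (suc k)
  c = 1ℚ - + 1 / suc h
  instance
    Hʰ>0 : ℚ.Positive (H ^ suc h)
    Hʰ>0 = subst ℚ.Positive (ι-^ (suc h) (suc h)) (ι-pos (suc h ℕ.^ suc h) {{m^n≢0 (suc h) (suc h)}})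
    Hʰ≥0 : ℚ.NonNegative (H ^ suc h)
    Hʰ≥0 = ℚ.pos⇒nonNeg (H ^ suc h)
    Kⁿ≥0 : ℚ.NonNegative (K ^ n)
    Kⁿ≥0 = subst ℚ.NonNegative (ι-^ (suc k) n) (ι-nonNeg (suc k ℕ.^ n))
  ι-*-^ : ∀ a m b n → ι (a ℕ.^ m * b ℕ.^ n) ≡ ι a ^ m ℚ.* ι b ^ n
  ι-*-^ a m b n = trans (ι-* (a ℕ.^ m) (b ℕ.^ n)) (cong₂ ℚ._*_ (ι-^ a m) (ι-^ b n))
  reorder : ∀ x y z → x ℚ.* y ℚ.* z ≡ x ℚ.* (z ℚ.* y)
  reorder = solve 3 (λ x y z → x :* y :* z := x :* (z :* y)) refl
  0≤Kt : ∀ {t} → 0ℚ ℚ.≤ t → 0ℚ ℚ.≤ K ℚ.* t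
  0≤Kt {t} 0≤t = ℚ.nonNegative⁻¹ (K ℚ.* t)
    {{ℚ.nonNeg*nonNeg⇒nonNeg K {{ι-nonNeg (suc k)}} t {{ℚ.nonNegative 0≤t}}}}

-- Cleared of division, 1 - 1/(k + 1) ≤ 1 - 1/(m + 1).
≤-downward : ∀ a b n {k m} → suc k ≤ suc m → a * m ℕ.^ n ≤ b * suc m ℕ.^ n →
             a * k ℕ.^ n ≤ b * suc k ℕ.^ n
≤-downward a b n {k} {m} k≤m am≤bm =
  *-cancelʳ-≤ _ _ (suc m ℕ.^ n) {{m^n≢0 (suc m) n}} (begin
    a * k ℕ.^ n * suc m ℕ.^ n      ≡⟨ *-assoc a _ _ ⟩
    a * (k ℕ.^ n * suc m ℕ.^ n)    ≡⟨ cong (a *_) (^-distribʳ-* k (suc m) n) ⟨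
    a * (k * suc m) ℕ.^ n          ≤⟨ *-monoʳ-≤ a (ℕ.^-monoˡ-≤ n cross) ⟩
    a * (suc k * m) ℕ.^ n          ≡⟨ cong (a *_) (^-distribʳ-* (suc k) m n) ⟩
    a * (suc k ℕ.^ n * m ℕ.^ n)    ≡⟨ swap a (suc k ℕ.^ n) (m ℕ.^ n) ⟩
    a * m ℕ.^ n * suc k ℕ.^ n      ≤⟨ *-monoˡ-≤ (suc k ℕ.^ n) am≤bm ⟩
    b * suc m ℕ.^ n * suc k ℕ.^ n  ≡⟨ swap′ b (suc m ℕ.^ n) (suc k ℕ.^ n) ⟩
    b * suc k ℕ.^ n * suc m ℕ.^ n  ∎)
  where
  open ≤-Reasoning
  swap : ∀ a b c → a * (b * c) ≡ a * c * b
  swap = solve-∀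
  swap′ : ∀ a b c → a * b * c ≡ a * c * b
  swap′ = solve-∀
  cross : k * suc m ≤ suc k * m
  cross = subst (_≤ m + k * m) (sym (*-suc k m)) (+-monoˡ-≤ (k * m) (s≤s⁻¹ k≤m))

theorem3 : ∀ (n h k : ℕ) .{{_ : NonZero n}} .{{_ : NonZero h}} .{{_ : NonZero k}} →
    (G : SimpleGraph n) → IsChromaticNumber G h →
    fromℚ (+ k / 1) >ℝ 1/ℝ (1ℚ ⊖ (1ℚ - + 1 / h) ^[ h / n ]) (0<1-[1-1/h]^[h/n] h n) →
    ∀ μ → IsHatChromaticNumber G μ → μ ≤ k ∸ 1
theorem3 n (suc h) (suc k) G (col , _) k> zero    _ = z≤n
-- The negated goal `k < suc m` is `suc k ≤ suc m`. The inequality for `suc m` colours then passes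
-- down to `suc k` colours by arithmetic alone, without restricting the strategies to fewer colours,
-- and contradicts the strict reverse inequality.
theorem3 n (suc h) (suc k) G (col , _) k> (suc m) (win , _) = ≮⇒≥ λ k≤m →
  <⇒≱ (>1/[1-[1-1/h]^[h/n]]⇒< n h k k>)
    (≤-downward (suc h ℕ.^ suc h) (h ℕ.^ suc h) n k≤m (winning⇒≤ G col win))
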